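{- For every $K_3N$ $n=pqr$, $$C\le\frac12\left(p^2+2p+\frac12\sqrt{4p-3}+\frac12\right),$$ with equality if and only if $E=2$ and $F=G=1$.
   Context: A $K_3N$ (Korselt number with three factors) is an integer $n$ together with a factorisation $n=pqr$, where $1<p<q<r$ are odd integers (not necessarily prime) such that each of $p-1,\ q-1,\ r-1$ divides $n-1$, and such that $E:=\dfrac{pq-1}{r-1}$ (which is an integer by the divisibility condition) satisfies $E\ge 2$. Put $H:=\gcd(p-1,q-1,r-1)$, $A:=\frac{p-1}{H}$, $B:=\frac{q-1}{H}$, $C:=\frac{r-1}{H}$, $F:=H\left(\frac1A+\frac1B+\frac1C\right)+\frac1{AB}+\frac1{AC}+\frac1{BC}$ (which is a positive integer), and $G:=AF-H$. -}

module Defs where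

open import Data.Empty using (⊥-elim)
open import Data.Integer.Base using (+_)
open import Data.Nat.Base as ℕ using (ℕ)
import Data.Nat.Properties as ℕₚ
open import Data.Nat.DivMod using (m≥n⇒m/n>0)
open import Data.Nat.Divisibility using (_∣_; ∣⇒≤; ∣-trans)
open import Data.Nat.GCD using (gcd; gcd[m,n]∣m; gcd[m,n]∣n; gcd[m,n]≢0)
open import Data.Product.Base using (∃; _×_; _,_)
open import Data.Rational.Base
open import Data.Rational.Properties
open import Data.Rational.Solver using (module +-*-Solver)
open import Data.Sum.Base using (_⊎_; inj₁; inj₂)
open import Relation.Binary.Definitions using (tri<; tri≈; tri>)
open import Relation.Binary.PropositionalEquality
open import Relation.Nullary using (¬_; yes; no)

ι : ℕ → ℚ
ι k = + k / 1

-- Two-sided Dedekind cuts: `lower q` is "q < x" and `upper q` is "x < q".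
record ℝ : Set₁ where
  field
    lower upper     : ℚ → Set
    lower-inhabited : ∃ lower
    upper-inhabited : ∃ upper
    lower-closed    : ∀ {s t} → s < t → lower t → lower s
    upper-closed    : ∀ {s t} → s < t → upper s → upper t
    lower-rounded   : ∀ {s} → lower s → ∃ λ t → s < t × lower t
    upper-rounded   : ∀ {t} → upper t → ∃ λ s → s < t × upper s
    disjoint        : ∀ {s} → lower s → ¬ upper s
    located         : ∀ {s t} → s < t → lower s ⊎ upper t

open ℝ

infix 4 _≤ᵣ_ _≃ᵣ_

_≤ᵣ_ : ℝ → ℝ → Set
x ≤ᵣ y = ∀ s → lower x s → lower y s

_≃ᵣ_ : ℝ → ℝ → Set
x ≃ᵣ y = x ≤ᵣ y × y ≤ᵣ x

private
  <-by : ∀ {x y} e → 0ℚ < e → y ≡ x + e → x < y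
  <-by {x} e 0<e refl = subst (_< x + e) (+-identityʳ x) (+-monoʳ-< x 0<e)

  diff>0 : ∀ {x y} → x < y → 0ℚ < y - x
  diff>0 {x} {y} x<y = subst (_< y - x) (+-inverseʳ x) (+-monoˡ-< (- x) x<y)

  +-nonNeg-pos : ∀ {x y} → 0ℚ ≤ x → 0ℚ < y → 0ℚ < x + y
  +-nonNeg-pos = +-mono-≤-<

  *-pos : ∀ {x y} → 0ℚ < x → 0ℚ < y → 0ℚ < x * y
  *-pos {x} {y} 0<x 0<y =
    subst (_< x * y) (*-zeroʳ x) (*-monoʳ-<-pos x {{positive 0<x}} 0<y)

  *-nonNeg : ∀ {x y} → 0ℚ ≤ x → 0ℚ ≤ y → 0ℚ ≤ x * y
  *-nonNeg {x} {y} 0≤x 0≤y =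
    subst (_≤ x * y) (*-zeroʳ x) (*-monoˡ-≤-nonNeg x {{nonNegative 0≤x}} 0≤y)

  square-mono-≤ : ∀ {x y} → 0ℚ ≤ x → x ≤ y → x * x ≤ y * y
  square-mono-≤ {x} {y} 0≤x x≤y = ≤-trans
    (*-monoˡ-≤-nonNeg x {{nonNegative 0≤x}} x≤y)
    (*-monoʳ-≤-nonNeg y {{nonNegative (≤-trans 0≤x x≤y)}} x≤y)

  double-mono : ∀ {x y} → x < y → x + x < y + y
  double-mono x<y = +-mono-< x<y x<y

  double-cancel : ∀ {x y} → x + x < y + y → x < y
  double-cancel {x} {y} 2x<2y with <-cmp x y
  ... | tri< x<y _ _ = x<y
  ... | tri≈ _ refl _ = ⊥-elim (<-irrefl refl 2x<2y)
  ... | tri> _ _ y<x = ⊥-elim (<-asym 2x<2y (double-mono y<x))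

  double-half : ∀ x → ½ * x + ½ * x ≡ x
  double-half = solve 1 (λ x → con ½ :* x :+ con ½ :* x := x) refl
    where open +-*-Solver

  add-sub : ∀ c x → (x + c) - c ≡ x
  add-sub = solve 2 (λ c x → (x :+ c) :- c := x) refl
    where open +-*-Solver

  sub-add : ∀ c x → (x - c) + c ≡ x
  sub-add = solve 2 (λ c x → (x :- c) :+ c := x) refl
    where open +-*-Solver

fromℚ : ℚ → ℝ
fromℚ c .lower s = s < c
fromℚ c .upper s = c < s
fromℚ c .lower-inhabited = c - 1ℚ , <-by 1ℚ (positive⁻¹ 1ℚ) (sym (sub-add 1ℚ c))
fromℚ c .upper-inhabited = c + 1ℚ , <-by 1ℚ (positive⁻¹ 1ℚ) refl
fromℚ c .lower-closed = <-trans
fromℚ c .upper-closed s<t c<s = <-trans c<s s<t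
fromℚ c .lower-rounded = <-dense
fromℚ c .upper-rounded c<t with <-dense c<t
... | s , c<s , s<t = s , s<t , c<s
fromℚ c .disjoint = <-asym
fromℚ c .located {s} {t} s<t with s <? c
... | yes s<c = inj₁ s<c
... | no s≮c = inj₂ (≤-<-trans (≮⇒≥ s≮c) s<t)

infixr 6 _⊕_

_⊕_ : ℚ → ℝ → ℝ
(c ⊕ x) .lower s = lower x (s - c)
(c ⊕ x) .upper s = upper x (s - c)
(c ⊕ x) .lower-inhabited with lower-inhabited x
... | s , l = s + c , subst (lower x) (sym (add-sub c s)) l
(c ⊕ x) .upper-inhabited with upper-inhabited x
... | s , u = s + c , subst (upper x) (sym (add-sub c s)) u
(c ⊕ x) .lower-closed s<t = lower-closed x (+-monoˡ-< (- c) s<t)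
(c ⊕ x) .upper-closed s<t = upper-closed x (+-monoˡ-< (- c) s<t)
(c ⊕ x) .lower-rounded {s} l with lower-rounded x l
... | t , s-c<t , l′ = t + c
  , subst (_< t + c) (sub-add c s) (+-monoˡ-< c s-c<t)
  , subst (lower x) (sym (add-sub c t)) l′
(c ⊕ x) .upper-rounded {t} u with upper-rounded x u
... | s , s<t-c , u′ = s + c
  , subst (s + c <_) (sub-add c t) (+-monoˡ-< c s<t-c)
  , subst (upper x) (sym (add-sub c s)) u′
(c ⊕ x) .disjoint = disjoint x
(c ⊕ x) .located s<t = located x (+-monoˡ-< (- c) s<t)

-- The real number x / 2: s < x / 2 means s + s < x.
half : ℝ → ℝ
half x .lower s = lower x (s + s)
half x .upper s = upper x (s + s)
half x .lower-inhabited with lower-inhabited x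
... | s , l = ½ * s , subst (lower x) (sym (double-half s)) l
half x .upper-inhabited with upper-inhabited x
... | s , u = ½ * s , subst (upper x) (sym (double-half s)) u
half x .lower-closed s<t = lower-closed x (double-mono s<t)
half x .upper-closed s<t = upper-closed x (double-mono s<t)
half x .lower-rounded {s} l with lower-rounded x l
... | t , 2s<t , l′ = ½ * t
  , double-cancel (subst (s + s <_) (sym (double-half t)) 2s<t)
  , subst (lower x) (sym (double-half t)) l′
half x .upper-rounded {t} u with upper-rounded x u
... | s , s<2t , u′ = ½ * s
  , double-cancel (subst (_< t + t) (sym (double-half s)) s<2t)
  , subst (upper x) (sym (double-half s)) u′
half x .disjoint = disjoint x
half x .located s<t = located x (double-mono s<t)

-- For s ≥ 0 and k² > m, the number (k s + m) / (s + k) lies strictly between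
-- s and √ m, on either side: its square minus m is
-- (k² - m) (s² - m) / (s + k)².  Here k = m + 1.
private
  module Approx (m s : ℚ) (0≤m : 0ℚ ≤ m) (0≤s : 0ℚ ≤ s) where
    open +-*-Solver

    k d N : ℚ
    k = m + 1ℚ
    d = s + k
    N = k * s + m

    0<1 : 0ℚ < 1ℚ
    0<1 = positive⁻¹ 1ℚ

    0<k : 0ℚ < k
    0<k = +-nonNeg-pos 0≤m 0<1

    0<d : 0ℚ < d
    0<d = +-nonNeg-pos 0≤s 0<k

    instance
      d≢0 : NonZero d
      d≢0 = >-nonZero 0<d

    0<k²-m : 0ℚ < m * m + m + 1ℚ
    0<k²-m = +-nonNeg-pos (+-mono-≤ (*-nonNeg 0≤m 0≤m) 0≤m) 0<1

    s′ : ℚ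
    s′ = N * 1/ d

    s′d : s′ * d ≡ N
    s′d = trans (*-assoc N (1/ d) d)
                (trans (cong (N *_) (*-inverseˡ d)) (*-identityʳ N))

    s′²d² : (s′ * s′) * (d * d) ≡ N * N
    s′²d² = trans (solve 2 (λ a b → (a :* a) :* (b :* b) := (a :* b) :* (a :* b)) refl s′ d)
                  (cong₂ _*_ s′d s′d)

    cancel-d : ∀ {x y} → x * d < y * d → x < y
    cancel-d = *-cancelʳ-<-nonNeg d {{nonNegative (<⇒≤ 0<d)}}

    cancel-d² : ∀ {x y} → x * (d * d) < y * (d * d) → x < y
    cancel-d² = *-cancelʳ-<-nonNeg (d * d) {{nonNegative (<⇒≤ (*-pos 0<d 0<d))}}

    s<s′ : s * s < m → s < s′
    s<s′ lt = cancel-d (subst (s * d <_) (sym s′d) (<-by (m - s * s) (diff>0 lt)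
      (solve 2 (λ m s → (m :+ con 1ℚ) :* s :+ m
                     := s :* (s :+ (m :+ con 1ℚ)) :+ (m :- s :* s)) refl m s)))

    s′²<m : s * s < m → s′ * s′ < m
    s′²<m lt = cancel-d² (subst (_< m * (d * d)) (sym s′²d²)
      (<-by ((m * m + m + 1ℚ) * (m - s * s)) (*-pos 0<k²-m (diff>0 lt))
      (solve 2 (λ m s → let k = m :+ con 1ℚ; d = s :+ k; N = k :* s :+ m in
        m :* (d :* d) := N :* N :+ (m :* m :+ m :+ con 1ℚ) :* (m :- s :* s)) refl m s)))

    s′<s : m < s * s → s′ < s
    s′<s lt = cancel-d (subst (_< s * d) (sym s′d) (<-by (s * s - m) (diff>0 lt)
      (solve 2 (λ m s → s :* (s :+ (m :+ con 1ℚ))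
                     := ((m :+ con 1ℚ) :* s :+ m) :+ (s :* s :- m)) refl m s)))

    m<s′² : m < s * s → m < s′ * s′
    m<s′² lt = cancel-d² (subst (m * (d * d) <_) (sym s′²d²)
      (<-by ((m * m + m + 1ℚ) * (s * s - m)) (*-pos 0<k²-m (diff>0 lt))
      (solve 2 (λ m s → let k = m :+ con 1ℚ; d = s :+ k; N = k :* s :+ m in
        N :* N := m :* (d :* d) :+ (m :* m :+ m :+ con 1ℚ) :* (s :* s :- m)) refl m s)))

    0<s′ : 0ℚ < s → 0ℚ < s′
    0<s′ 0<s = cancel-d (subst₂ _<_ (sym (*-zeroˡ d)) (sym s′d)
      (subst (0ℚ <_) (+-comm m (k * s)) (+-nonNeg-pos 0≤m (*-pos 0<k 0<s))))

-- The cut of the non-negative square root; for m < 0 it is the cut of 0.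
√ : ℚ → ℝ
√ m .lower s = s < 0ℚ ⊎ s * s < m
√ m .upper s = 0ℚ < s × m < s * s
√ m .lower-inhabited = - 1ℚ , inj₁ (negative⁻¹ (- 1ℚ))
√ m .upper-inhabited with m <? 1ℚ
... | yes m<1 = 1ℚ , positive⁻¹ 1ℚ , m<1
... | no m≮1 = m + 1ℚ , 0<m+1 , <-by (m * m + m + 1ℚ) 0<e
      (solve 1 (λ m → (m :+ con 1ℚ) :* (m :+ con 1ℚ)
                   := m :+ (m :* m :+ m :+ con 1ℚ)) refl m)
  where
  open +-*-Solver
  0≤m : 0ℚ ≤ m
  0≤m = ≤-trans (<⇒≤ (positive⁻¹ 1ℚ)) (≮⇒≥ m≮1)
  0<m+1 : 0ℚ < m + 1ℚ
  0<m+1 = +-nonNeg-pos 0≤m (positive⁻¹ 1ℚ)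
  0<e : 0ℚ < m * m + m + 1ℚ
  0<e = +-nonNeg-pos (+-mono-≤ (*-nonNeg 0≤m 0≤m) 0≤m) (positive⁻¹ 1ℚ)
√ m .lower-closed s<t (inj₁ t<0) = inj₁ (<-trans s<t t<0)
√ m .lower-closed {s} s<t (inj₂ t²<m) with s <? 0ℚ
... | yes s<0 = inj₁ s<0
... | no s≮0 = inj₂ (≤-<-trans (square-mono-≤ (≮⇒≥ s≮0) (<⇒≤ s<t)) t²<m)
√ m .upper-closed s<t (0<s , m<s²) =
  <-trans 0<s s<t , <-≤-trans m<s² (square-mono-≤ (<⇒≤ 0<s) (<⇒≤ s<t))
√ m .lower-rounded {s} l with s <? 0ℚ
√ m .lower-rounded {s} l | yes s<0 with <-dense s<0
... | t , s<t , t<0 = t , s<t , inj₁ t<0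
√ m .lower-rounded {s} (inj₁ s<0) | no s≮0 = ⊥-elim (s≮0 s<0)
√ m .lower-rounded {s} (inj₂ s²<m) | no s≮0 =
  s′ , s<s′ s²<m , inj₂ (s′²<m s²<m)
  where
  0≤s : 0ℚ ≤ s
  0≤s = ≮⇒≥ s≮0
  0≤m : 0ℚ ≤ m
  0≤m = <⇒≤ (≤-<-trans (*-nonNeg 0≤s 0≤s) s²<m)
  open Approx m s 0≤m 0≤s
√ m .upper-rounded {t} (0<t , m<t²) with m <? 0ℚ
√ m .upper-rounded {t} (0<t , m<t²) | yes m<0 with <-dense 0<t
... | s , 0<s , s<t = s , s<t , 0<s , <-trans m<0 (*-pos 0<s 0<s)
√ m .upper-rounded {t} (0<t , m<t²) | no m≮0 =
  s′ , s′<s m<t² , 0<s′ 0<t , m<s′² m<t²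
  where open Approx m t (≮⇒≥ m≮0) (<⇒≤ 0<t)
√ m .disjoint (inj₁ s<0) (0<s , _) = <-asym s<0 0<s
√ m .disjoint (inj₂ s²<m) (_ , m<s²) = <-asym s²<m m<s²
√ m .located {s} {t} s<t with s <? 0ℚ | s * s <? m
... | yes s<0 | _ = inj₁ (inj₁ s<0)
... | no _ | yes s²<m = inj₁ (inj₂ s²<m)
... | no s≮0 | no s²≮m = inj₂ (≤-<-trans 0≤s s<t , ≤-<-trans (≮⇒≥ s²≮m) s²<t²)
  where
  0≤s : 0ℚ ≤ s
  0≤s = ≮⇒≥ s≮0
  s²<t² : s * s < t * t
  s²<t² = ≤-<-trans (*-monoˡ-≤-nonNeg s {{nonNegative 0≤s}} (<⇒≤ s<t))
    (*-monoˡ-<-pos t {{positive (≤-<-trans 0≤s s<t)}} s<t)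

record K₃N : Set where
  field
    n p q r       : ℕ
    factorisation : n ≡ p ℕ.* q ℕ.* r
    1<p           : 1 ℕ.< p
    p<q           : p ℕ.< q
    q<r           : q ℕ.< r
    p-odd         : ¬ 2 ∣ p
    q-odd         : ¬ 2 ∣ q
    r-odd         : ¬ 2 ∣ r
    p-1∣n-1       : p ℕ.∸ 1 ∣ n ℕ.∸ 1
    q-1∣n-1       : q ℕ.∸ 1 ∣ n ℕ.∸ 1
    r-1∣n-1       : r ℕ.∸ 1 ∣ n ℕ.∸ 1

  instance
    p-1≢0 : ℕ.NonZero (p ℕ.∸ 1)
    p-1≢0 = ℕ.>-nonZero (ℕₚ.m<n⇒0<n∸m 1<p)

    q-1≢0 : ℕ.NonZero (q ℕ.∸ 1)
    q-1≢0 = ℕ.>-nonZero (ℕₚ.m<n⇒0<n∸m (ℕₚ.<-trans 1<p p<q))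

    r-1≢0 : ℕ.NonZero (r ℕ.∸ 1)
    r-1≢0 = ℕ.>-nonZero (ℕₚ.m<n⇒0<n∸m (ℕₚ.<-trans 1<p (ℕₚ.<-trans p<q q<r)))

  E : ℚ
  E = + (p ℕ.* q ℕ.∸ 1) / (r ℕ.∸ 1)

  field
    2≤E : ι 2 ≤ E

  H : ℕ
  H = gcd (p ℕ.∸ 1) (gcd (q ℕ.∸ 1) (r ℕ.∸ 1))

  H∣p-1 : H ∣ p ℕ.∸ 1
  H∣p-1 = gcd[m,n]∣m _ _

  H∣q-1 : H ∣ q ℕ.∸ 1
  H∣q-1 = ∣-trans (gcd[m,n]∣n (p ℕ.∸ 1) _) (gcd[m,n]∣m _ _)

  H∣r-1 : H ∣ r ℕ.∸ 1
  H∣r-1 = ∣-trans (gcd[m,n]∣n (p ℕ.∸ 1) _) (gcd[m,n]∣n (q ℕ.∸ 1) _)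

  instance
    H≢0 : ℕ.NonZero H
    H≢0 = ℕ.≢-nonZero (gcd[m,n]≢0 _ _ (inj₁ (ℕ.≢-nonZero⁻¹ (p ℕ.∸ 1))))

  -- These natural-number quotients are exact, since H is the gcd.
  A B C : ℕ
  A = (p ℕ.∸ 1) ℕ./ H
  B = (q ℕ.∸ 1) ℕ./ H
  C = (r ℕ.∸ 1) ℕ./ H

  instance
    A≢0 : ℕ.NonZero A
    A≢0 = ℕ.>-nonZero (m≥n⇒m/n>0 (∣⇒≤ H∣p-1))

    B≢0 : ℕ.NonZero B
    B≢0 = ℕ.>-nonZero (m≥n⇒m/n>0 (∣⇒≤ H∣q-1))

    C≢0 : ℕ.NonZero C
    C≢0 = ℕ.>-nonZero (m≥n⇒m/n>0 (∣⇒≤ H∣r-1))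

    AB≢0 : ℕ.NonZero (A ℕ.* B)
    AB≢0 = ℕₚ.m*n≢0 A B

    AC≢0 : ℕ.NonZero (A ℕ.* C)
    AC≢0 = ℕₚ.m*n≢0 A C

    BC≢0 : ℕ.NonZero (B ℕ.* C)
    BC≢0 = ℕₚ.m*n≢0 B C

  F G : ℚ
  F = ι H * (+ 1 / A + + 1 / B + + 1 / C)
      + (+ 1 / (A ℕ.* B) + + 1 / (A ℕ.* C) + + 1 / (B ℕ.* C))
  G = ι A * F - ι H

-- ½ (p² + 2p + ½ √(4p - 3) + ½), with the rational terms collected on the left.
bound : ℕ → ℝ
bound p = half ((ι p * ι p + ι 2 * ι p) ⊕ ½ ⊕ half (√ (ι 4 * ι p - ι 3)))

{-# OPTIONS --safe #-}
-- Write e, f, g for E, F, G.  The divisibility conditions, with A and B coprime,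
-- give p = 1 + H A, e C = p B + A, g B = p + e and f A = g + H.  Hence
-- C = p² / (g e) + p / g + A / e, which is largest at e = 2, g = 1, where
-- 2 C = p² + 2 p + A; in every other case already 4 C < 2 p² + 4 p + 1.  For
-- g = 1 the relation f A = 1 + H gives A ≤ 1 + H, that is (2 A - 1)² ≤ 4 p - 3,
-- with equality exactly when f = 1.

module Submission where

open import Defs
open import Data.Empty using (⊥-elim)
open import Data.Integer.Base as ℤ using (+_)
import Data.Integer.Properties as ℤₚ
open import Data.Nat.Base as ℕ using (ℕ; zero; suc; z≤n; s≤s)
import Data.Nat.Properties as ℕₚ
open import Data.Nat.Coprimality as Coprimality using (Coprime; coprime-divisor)
open import Data.Nat.DivMod using (m/n*n≡m)
open import Data.Nat.Divisibility
  using (_∣_; n∣m*n; m∣m*n; ∣m+n∣m⇒∣n; ∣m∣n⇒∣m+n; ∣-trans; ∣1⇒≡1; *-cancelʳ-∣; *-monoˡ-∣)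
open import Data.Nat.GCD using (gcd; gcd-greatest)
open import Data.Nat.Tactic.RingSolver using (solve-∀)
open import Data.Product.Base using (_×_; _,_; proj₁; proj₂)
open import Data.Sum.Base using (_⊎_; inj₁; inj₂)
open import Function.Bundles using (_⇔_; mk⇔)
open import Function.Properties.Equivalence using () renaming (trans to ⇔-trans)
open import Relation.Binary.PropositionalEquality
open import Relation.Nullary using (¬_; yes; no)

-- Divisibility relations among `A`, `B`, `C` and the quotients `e`, `g`, `f`.

module Arithmetic where
  open import Data.Nat.Base

  product-1 : ∀ x y h → suc (x * h) * suc (y * h) ∸ 1 ≡ (x + y + h * x * y) * h
  product-1 x y h = ℕₚ.suc-injective (identity x y h)
    where
    identity : ∀ x y h → suc (x * h) * suc (y * h) ≡ suc ((x + y + h * x * y) * h)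
    identity = solve-∀

  -- Modulo `r - 1 = z h` the factor `r` is 1, so `z h` divides `p q - 1 = (x + y + h x y) h`, and
  -- `h` cancels.
  korselt-∣ : ∀ x y z h .{{_ : NonZero h}} {p q r} →
              p ≡ suc (x * h) → q ≡ suc (y * h) → r ≡ suc (z * h) →
              r ∸ 1 ∣ p * q * r ∸ 1 → z ∣ x + y + h * x * y
  korselt-∣ x y z h refl refl refl zh∣ = *-cancelʳ-∣ h (∣m+n∣m⇒∣n
    (subst (z * h ∣_) (ℕₚ.suc-injective (identity x y z h)) zh∣)
    (n∣m*n (suc (x * h) * suc (y * h))))
    where
    identity : ∀ x y z h → suc (x * h) * suc (y * h) * suc (z * h)
                         ≡ suc (suc (x * h) * suc (y * h) * (z * h) + (x + y + h * x * y) * h)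
    identity = solve-∀

  -- A common divisor `d` of `A` and `B` also divides `C = k B - A (1 + H C)`; then `d H` divides
  -- the gcd `H`, which forces `d = 1`.
  coprime-AB : ∀ A B C H k .{{_ : NonZero H}} → gcd (A * H) (gcd (B * H) (C * H)) ≡ H →
               k * B ≡ A + C + H * A * C → Coprime A B
  coprime-AB A B C H k gcd≡H kB {d} (d∣A , d∣B) = ∣1⇒≡1 (*-cancelʳ-∣ H dH∣1H)
    where
    d∣C : d ∣ C
    d∣C = ∣m+n∣m⇒∣n
      (subst (d ∣_) (trans kB (identity A C H)) (∣-trans d∣B (n∣m*n k)))
      (∣-trans d∣A (m∣m*n (1 + H * C)))
      where
      identity : ∀ A C H → A + C + H * A * C ≡ A * (1 + H * C) + C
      identity = solve-∀
    dH∣1H : d * H ∣ 1 * H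
    dH∣1H = subst (d * H ∣_) (trans gcd≡H (sym (ℕₚ.*-identityˡ H)))
      (gcd-greatest (*-monoˡ-∣ H d∣A) (gcd-greatest (*-monoˡ-∣ H d∣B) (*-monoˡ-∣ H d∣C)))

  -- Multiplying the relation for `k B` by `e` and substituting `e C` gives
  -- `e k B = p² B + A (p + e)`. Hence `B` divides `A (p + e)`, and `A` is coprime to it.
  B∣p+e : ∀ A B C H e k → Coprime A B →
          e * C ≡ A + B + H * A * B → k * B ≡ A + C + H * A * C →
          B ∣ 1 + H * A + e
  B∣p+e A B C H e k A⊥B eC kB = coprime-divisor (Coprimality.sym A⊥B)
    (∣m+n∣m⇒∣n {m = p * p * B} (subst (B ∣_) (sym eq) (n∣m*n (e * k))) (n∣m*n (p * p)))
    where
    open ≡-Reasoning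
    p = 1 + H * A
    i₁ : ∀ A B H e → (1 + H * A) * (1 + H * A) * B + A * (1 + H * A + e)
                     ≡ (1 + H * A) * (A + B + H * A * B) + e * A
    i₁ = solve-∀
    i₂ : ∀ A C H e → (1 + H * A) * (e * C) + e * A ≡ e * (A + C + H * A * C)
    i₂ = solve-∀
    eq : p * p * B + A * (p + e) ≡ e * k * B
    eq = begin
      p * p * B + A * (p + e)             ≡⟨ i₁ A B H e ⟩
      p * (A + B + H * A * B) + e * A     ≡⟨ cong (λ x → p * x + e * A) eC ⟨
      p * (e * C) + e * A                 ≡⟨ i₂ A C H e ⟩
      e * (A + C + H * A * C)             ≡⟨ cong (e *_) kB ⟨
      e * (k * B)                         ≡⟨ ℕₚ.*-assoc e k B ⟨
      e * k * B                           ∎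

  -- Substituting `e C` into `e l A` leaves `B (1 + e + H B)` modulo `A`, so `A` divides
  -- `1 + e + H B`. Adding `H A` turns this into `g B + H B = B (g + H)`, and `B` is cancelled by
  -- coprimality once more.
  A∣g+H : ∀ A B C H e l g → Coprime A B →
          e * C ≡ A + B + H * A * B → l * A ≡ B + C + H * B * C →
          g * B ≡ 1 + H * A + e → A ∣ g + H
  A∣g+H A B C H e l g A⊥B eC lA gB = coprime-divisor A⊥B
    (subst (A ∣_) eq (∣m∣n⇒∣m+n A∣1+e+HB (n∣m*n H)))
    where
    open ≡-Reasoning
    i₁ : ∀ B C H e → e * (B + C + H * B * C) ≡ e * B + (1 + H * B) * (e * C)
    i₁ = solve-∀
    i₂ : ∀ A B H e → e * B + (1 + H * B) * (A + B + H * A * B)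
                     ≡ A * ((1 + H * B) * (1 + H * B)) + B * (1 + e + H * B)
    i₂ = solve-∀
    i₃ : ∀ A B H e → 1 + e + H * B + H * A ≡ 1 + H * A + e + H * B
    i₃ = solve-∀
    i₄ : ∀ B H g → g * B + H * B ≡ B * (g + H)
    i₄ = solve-∀
    A∣1+e+HB : A ∣ 1 + e + H * B
    A∣1+e+HB = coprime-divisor A⊥B (∣m+n∣m⇒∣n
      (subst (A ∣_) (begin
        e * (l * A)                                ≡⟨ cong (e *_) lA ⟩
        e * (B + C + H * B * C)                    ≡⟨ i₁ B C H e ⟩
        e * B + (1 + H * B) * (e * C)              ≡⟨ cong (λ x → e * B + (1 + H * B) * x) eC ⟩
        e * B + (1 + H * B) * (A + B + H * A * B)  ≡⟨ i₂ A B H e ⟩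
        A * ((1 + H * B) * (1 + H * B)) + B * (1 + e + H * B) ∎)
        (∣-trans (n∣m*n l) (n∣m*n e)))
      (m∣m*n _))
    eq : 1 + e + H * B + H * A ≡ B * (g + H)
    eq = begin
      1 + e + H * B + H * A  ≡⟨ i₃ A B H e ⟩
      1 + H * A + e + H * B  ≡⟨ cong (_+ H * B) gB ⟨
      g * B + H * B          ≡⟨ i₄ B H g ⟩
      B * (g + H)            ∎

  -- Formulas for `C` and `F`, and the bound on `C` in natural numbers.

  geC-expand : ∀ A B C H e g → e * C ≡ A + B + H * A * B → g * B ≡ 1 + H * A + e →
               let p = 1 + H * A in g * e * C ≡ p * (p + e) + g * A
  geC-expand A B C H e g eC gB = begin
    g * e * C                     ≡⟨ ℕₚ.*-assoc g e C ⟩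
    g * (e * C)                   ≡⟨ cong (g *_) eC ⟩
    g * (A + B + H * A * B)       ≡⟨ identity A B H g ⟩
    (1 + H * A) * (g * B) + g * A ≡⟨ cong (λ x → (1 + H * A) * x + g * A) gB ⟩
    (1 + H * A) * (1 + H * A + e) + g * A ∎
    where
    open ≡-Reasoning
    identity : ∀ A B H g → g * (A + B + H * A * B) ≡ (1 + H * A) * (g * B) + g * A
    identity = solve-∀

  -- This is the definition of `F` with denominators cleared; it identifies the quotient `f` of
  -- `g + H` by `A` with `F`.
  FABC-expand : ∀ A B C H e g f →
    e * C ≡ A + B + H * A * B → g * B ≡ 1 + H * A + e → f * A ≡ g + H →
    f * (A * B * C) ≡ H * (B * C + A * C + A * B) + (C + B + A)
  FABC-expand A B C H e g f eC gB fA = begin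
    f * (A * B * C)                            ≡⟨ i₁ A B C f ⟩
    f * A * (B * C)                            ≡⟨ cong (_* (B * C)) fA ⟩
    (g + H) * (B * C)                          ≡⟨ i₂ B C H g ⟩
    g * B * C + H * B * C                      ≡⟨ cong (λ x → x * C + H * B * C) gB ⟩
    (1 + H * A + e) * C + H * B * C            ≡⟨ i₃ A B C H e ⟩
    (1 + H * A) * C + H * B * C + e * C        ≡⟨ cong (λ x → (1 + H * A) * C + H * B * C + x) eC ⟩
    (1 + H * A) * C + H * B * C + (A + B + H * A * B) ≡⟨ i₄ A B C H ⟩
    H * (B * C + A * C + A * B) + (C + B + A)  ∎
    where
    open ≡-Reasoning
    i₁ : ∀ A B C f → f * (A * B * C) ≡ f * A * (B * C)
    i₁ = solve-∀
    i₂ : ∀ B C H g → (g + H) * (B * C) ≡ g * B * C + H * B * C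
    i₂ = solve-∀
    i₃ : ∀ A B C H e → (1 + H * A + e) * C + H * B * C ≡ (1 + H * A) * C + H * B * C + e * C
    i₃ = solve-∀
    i₄ : ∀ A B C H → (1 + H * A) * C + H * B * C + (A + B + H * A * B) ≡ H * (B * C + A * C + A * B) + (C + B + A)
    i₄ = solve-∀

  -- After multiplying by g e and substituting p = A + 1 + d, the difference of
  -- the two sides has non-negative coefficients; it is the second argument of m≤m+n.
  slack-or-tight : ∀ p A C e g → A < p → 2 ≤ e → 1 ≤ g → g * e * C ≡ p * (p + e) + g * A →
    (e ≡ 2 × g ≡ 1) ⊎ ¬ (e ≡ 2 × g ≡ 1) × 4 * C < 2 * p * p + 4 * p + 1
  slack-or-tight p A C 1 g _ (s≤s ()) _ _
  slack-or-tight p A C 2 1 _ _ _ _ = inj₁ (refl , refl)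
  slack-or-tight p A C e@(suc (suc (suc e′))) 1 A<p _ _ geC with ℕₚ.m≤n⇒∃[o]m+o≡n A<p
  ... | d , refl = inj₂ ((λ ()) , ℕₚ.*-cancelˡ-< e _ _ (subst₂ _≤_
          (cong suc (trans (cong (4 *_) (sym geC)) (i₁ e C)))
          (i₂ A d e′)
          (ℕₚ.m≤m+n (suc (4 * (p * (p + e) + 1 * A))) (2 * (A * A + 2 * A * d + suc d * suc d) + 2 * e′ * p * p + 2 + e′))))
    where
    i₁ : ∀ e C → 4 * (1 * e * C) ≡ e * (4 * C)
    i₁ = solve-∀
    i₂ : ∀ A d e′ → let p = suc A + d; e = suc (suc (suc e′)) in
         suc (4 * (p * (p + e) + 1 * A)) + (2 * (A * A + 2 * A * d + suc d * suc d) + 2 * e′ * p * p + 2 + e′)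
         ≡ e * (2 * p * p + 4 * p + 1)
    i₂ = solve-∀
  slack-or-tight p A C e@(suc (suc e′)) g@(suc (suc g′)) A<p _ _ geC with ℕₚ.m≤n⇒∃[o]m+o≡n A<p
  ... | d , refl = inj₂ ((λ ()) , ℕₚ.*-cancelˡ-< (g * e) _ _ (subst₂ _≤_
          (cong suc (trans (cong (4 *_) (sym geC)) (i₁ (g * e) C)))
          (i₂ A d e′ g′)
          (ℕₚ.m≤m+n (suc (4 * (p * (p + e) + g * A)))
             (p * p * (4 + 4 * g′ + 4 * e′ + 2 * g′ * e′) + 4 * (p * (g′ + e′ + g′ * e′) + suc d * g)
               + (3 + 2 * g′ + 2 * e′ + g′ * e′)))))
    where
    i₁ : ∀ n C → 4 * (n * C) ≡ n * (4 * C)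
    i₁ = solve-∀
    i₂ : ∀ A d e′ g′ → let p = suc A + d; e = suc (suc e′); g = suc (suc g′) in
         suc (4 * (p * (p + e) + g * A))
           + (p * p * (4 + 4 * g′ + 4 * e′ + 2 * g′ * e′) + 4 * (p * (g′ + e′ + g′ * e′) + suc d * g)
               + (3 + 2 * g′ + 2 * e′ + g′ * e′))
         ≡ g * e * (2 * p * p + 4 * p + 1)
    i₂ = solve-∀

  -- With `A = suc a` the surplus of `4 C` over `2 p² + 4 p + 1` is `2 A - 1 = 1 + 2 a`. The summand
  -- 0 gives the equation the shape that `excess-ι` expects.
  tight-excess : ∀ p a C → 1 * 2 * C ≡ p * (p + 2) + 1 * suc a →
                 4 * C + 0 ≡ 2 * p * p + 4 * p + 1 + (1 + 2 * a)
  tight-excess p a C 2C = trans (i₁ C) (trans (cong (2 *_) 2C) (i₂ p a))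
    where
    i₁ : ∀ C → 4 * C + 0 ≡ 2 * (1 * 2 * C)
    i₁ = solve-∀
    i₂ : ∀ p a → 2 * (p * (p + 2) + 1 * suc a) ≡ 2 * p * p + 4 * p + 1 + (1 + 2 * a)
    i₂ = solve-∀

  odd-square : ∀ a → (1 + 2 * a) * (1 + 2 * a) ≡ 1 + 4 * (a * suc a)
  odd-square = solve-∀

open Arithmetic

-- Natural numbers inside the rationals.

open import Data.Rational.Base
open import Data.Rational.Properties
open import Data.Rational.Solver using (module +-*-Solver)
import Data.Rational.Unnormalised.Base as ℚᵘ
import Data.Rational.Unnormalised.Properties as ℚᵘₚ

-- `ι m` is defined through normalisation by a gcd, which is stuck for variable `m`; in constructor
-- form, sums, products and order compute.
ι≡mkℚ : ∀ m → ι m ≡ mkℚ (+ m) 0 (Coprimality.sym (Coprimality.1-coprimeTo m))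
ι≡mkℚ m = normalize-coprime _

ι-homo-+ : ∀ m n → ι (m ℕ.+ n) ≡ ι m + ι n
ι-homo-+ m n rewrite ι≡mkℚ m | ι≡mkℚ n =
  cong (_/ 1) (sym (cong₂ ℤ._+_ (ℤₚ.*-identityʳ (+ m)) (ℤₚ.*-identityʳ (+ n))))

ι-homo-* : ∀ m n → ι (m ℕ.* n) ≡ ι m * ι n
ι-homo-* m n rewrite ι≡mkℚ m | ι≡mkℚ n = cong (_/ 1) (ℤₚ.pos-* m n)

ι-mono-≤ : ∀ {m n} → m ℕ.≤ n → ι m ≤ ι n
ι-mono-≤ {m} {n} m≤n rewrite ι≡mkℚ m | ι≡mkℚ n =
  *≤* (subst₂ ℤ._≤_ (sym (ℤₚ.*-identityʳ (+ m))) (sym (ℤₚ.*-identityʳ (+ n))) (ℤ.+≤+ m≤n))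

ι-cancel-≤ : ∀ {m n} → ι m ≤ ι n → m ℕ.≤ n
ι-cancel-≤ {m} {n} ιm≤ιn rewrite ι≡mkℚ m | ι≡mkℚ n =
  ℤₚ.drop‿+≤+ (subst₂ ℤ._≤_ (ℤₚ.*-identityʳ (+ m)) (ℤₚ.*-identityʳ (+ n)) (drop-*≤* ιm≤ιn))

ι-injective : ∀ {m n} → ι m ≡ ι n → m ≡ n
ι-injective {m} {n} eq = ℕₚ.≤-antisym
  (ι-cancel-≤ {m} {n} (≤-reflexive eq)) (ι-cancel-≤ {n} {m} (≤-reflexive (sym eq)))

ι-nonNeg : ∀ m → 0ℚ ≤ ι m
ι-nonNeg m = ι-mono-≤ {0} {m} z≤n

ι-pos : ∀ m .{{_ : ℕ.NonZero m}} → 0ℚ < ι m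
ι-pos (suc m) = <-≤-trans (positive⁻¹ 1ℚ) (ι-mono-≤ {1} {suc m} (s≤s z≤n))

ι-cancelʳ : ∀ m .{{_ : ℕ.NonZero m}} {x y} → x * ι m ≡ y * ι m → x ≡ y
ι-cancelʳ m eq = ≤-antisym
  (*-cancelʳ-≤-pos (ι m) {{positive (ι-pos m)}} (≤-reflexive eq))
  (*-cancelʳ-≤-pos (ι m) {{positive (ι-pos m)}} (≤-reflexive (sym eq)))

-- Among unnormalised fractions no gcd intervenes, and the claim is a cross-multiplication.
/-*-ι : ∀ m n .{{_ : ℕ.NonZero n}} → + m / n * ι n ≡ ι m
/-*-ι m n@(suc n-1) = toℚᵘ-injective (begin
  toℚᵘ (+ m / n * ι n)                       ≈⟨ toℚᵘ-homo-* (+ m / n) (ι n) ⟩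
  toℚᵘ (+ m / n) ℚᵘ.* toℚᵘ (ι n)             ≈⟨ ℚᵘₚ.*-cong (toℚᵘ-fromℚᵘ (ℚᵘ.mkℚᵘ (+ m) n-1)) (toℚᵘ-fromℚᵘ (ℚᵘ.mkℚᵘ (+ n) 0)) ⟩
  ℚᵘ.mkℚᵘ (+ m) n-1 ℚᵘ.* ℚᵘ.mkℚᵘ (+ n) 0     ≈⟨ ℚᵘ.*≡* (trans (ℤₚ.*-identityʳ (+ m ℤ.* + n)) (cong (λ k → + m ℤ.* + k) (sym (ℕₚ.*-identityʳ n)))) ⟩
  ℚᵘ.mkℚᵘ (+ m) 0                            ≈⟨ toℚᵘ-fromℚᵘ (ℚᵘ.mkℚᵘ (+ m) 0) ⟨
  toℚᵘ (ι m)                                 ∎)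
  where open ℚᵘₚ.≃-Reasoning

-- Comparing a rational with `bound p` through squares.

square-mono-< : ∀ {x y} → 0ℚ ≤ x → x < y → x * x < y * y
square-mono-< {x} {y} 0≤x x<y = ≤-<-trans
  (*-monoˡ-≤-nonNeg x {{nonNegative 0≤x}} (<⇒≤ x<y))
  (*-monoˡ-<-pos y {{positive (≤-<-trans 0≤x x<y)}} x<y)

square-cancel-< : ∀ {x y} → 0ℚ ≤ y → x * x < y * y → x < y
square-cancel-< {x} {y} 0≤y x²<y² with x <? y
... | yes x<y = x<y
... | no x≮y = ⊥-elim (<-irrefl refl (<-≤-trans x²<y² (≤-trans
  (*-monoˡ-≤-nonNeg y {{nonNegative 0≤y}} (≮⇒≥ x≮y))
  (*-monoʳ-≤-nonNeg x {{nonNegative (≤-trans 0≤y (≮⇒≥ x≮y))}} (≮⇒≥ x≮y)))))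

-- The affine map in s with s < bound p exactly when excess p s < √ (4p - 3).
excess : ℕ → ℚ → ℚ
excess p s = t + t
  where t = s + s - (ι p * ι p + ι 2 * ι p) - ½

radicand : ℕ → ℚ
radicand p = ι 4 * ι p - ι 3

excess-mono-< : ∀ p {s t} → s < t → excess p s < excess p t
excess-mono-< p s<t = +-mono-< lt lt
  where lt = +-monoˡ-< (- ½) (+-monoˡ-< (- (ι p * ι p + ι 2 * ι p)) (+-mono-< s<t s<t))

excess-cancel-< : ∀ p {s t} → excess p s < excess p t → s < t
excess-cancel-< p {s} {t} lt = ≰⇒> λ t≤s →
  let le = +-monoˡ-≤ (- ½) (+-monoˡ-≤ (- (ι p * ι p + ι 2 * ι p)) (+-mono-≤ t≤s t≤s))
  in <-irrefl refl (<-≤-trans lt (+-mono-≤ le le))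

-- The conclusion is `lower (√ m) x` unfolded. The weak inequalities on `y` suffice because `x < y`
-- supplies the strictness.
<√ : ∀ {x y m} → x < y → y ≤ 0ℚ ⊎ y * y ≤ m → x < 0ℚ ⊎ x * x < m
<√ x<y (inj₁ y≤0) = inj₁ (<-≤-trans x<y y≤0)
<√ {x} x<y (inj₂ y²≤m) with x <? 0ℚ
... | yes x<0 = inj₁ x<0
... | no x≮0 = inj₂ (<-≤-trans (square-mono-< (≮⇒≥ x≮0) x<y) y²≤m)

-- `lower (bound p) s` unfolds definitionally to `lower (√ (radicand p)) (excess p s)`, so
-- monotonicity of `excess` reduces the claim to `<√`.
excess≤√⇒≤bound : ∀ p c → excess p c ≤ 0ℚ ⊎ excess p c * excess p c ≤ radicand p →
                  fromℚ c ≤ᵣ bound p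
excess≤√⇒≤bound p c le s s<c = <√ (excess-mono-< p s<c) le

√≤excess⇒bound≤ : ∀ p c → 0ℚ ≤ excess p c → radicand p ≤ excess p c * excess p c →
                  bound p ≤ᵣ fromℚ c
√≤excess⇒bound≤ p c nonNeg ≤sq s (inj₁ neg) = excess-cancel-< p (<-≤-trans neg nonNeg)
√≤excess⇒bound≤ p c nonNeg ≤sq s (inj₂ sq<) =
  excess-cancel-< p (square-cancel-< nonNeg (<-≤-trans sq< ≤sq))

-- If either inequality failed, `c` itself would lie in the lower cut of `bound p`, and the
-- hypothesis would give `c < c`.
bound≤⇒√≤excess : ∀ p c → bound p ≤ᵣ fromℚ c →
                  0ℚ ≤ excess p c × radicand p ≤ excess p c * excess p c
bound≤⇒√≤excess p c bound≤c =
  ≮⇒≥ (λ neg → <-irrefl refl (bound≤c c (inj₁ neg))) ,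
  ≮⇒≥ (λ sq< → <-irrefl refl (bound≤c c (inj₂ sq<)))

excess-ι : ∀ p c {m n} → 4 ℕ.* c ℕ.+ m ≡ 2 ℕ.* p ℕ.* p ℕ.+ 4 ℕ.* p ℕ.+ 1 ℕ.+ n →
           excess p (ι c) ≡ ι n - ι m
excess-ι p c {m} {n} eq = begin
  excess p (ι c)
    ≡⟨ solve 3 (λ P C M → let T = C :+ C :- (P :* P :+ con (ι 2) :* P) :- con ½ in
         T :+ T := con (ι 4) :* C :+ M :- M :- (con (ι 2) :* P :* P :+ con (ι 4) :* P :+ con 1ℚ))
       refl (ι p) (ι c) (ι m) ⟩
  ι 4 * ι c + ι m - ι m - Q
    ≡⟨ cong (λ x → x - ι m - Q) eq′ ⟩
  Q + ι n - ι m - Q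
    ≡⟨ solve 3 (λ Q N M → Q :+ N :- M :- Q := N :- M) refl Q (ι n) (ι m) ⟩
  ι n - ι m ∎
  where
  open ≡-Reasoning
  open +-*-Solver
  Q = ι 2 * ι p * ι p + ι 4 * ι p + 1ℚ
  ι-Q : ι (2 ℕ.* p ℕ.* p ℕ.+ 4 ℕ.* p ℕ.+ 1) ≡ Q
  ι-Q = begin
    ι (2 ℕ.* p ℕ.* p ℕ.+ 4 ℕ.* p ℕ.+ 1)     ≡⟨ ι-homo-+ (2 ℕ.* p ℕ.* p ℕ.+ 4 ℕ.* p) 1 ⟩
    ι (2 ℕ.* p ℕ.* p ℕ.+ 4 ℕ.* p) + 1ℚ      ≡⟨ cong (_+ 1ℚ) (ι-homo-+ (2 ℕ.* p ℕ.* p) (4 ℕ.* p)) ⟩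
    ι (2 ℕ.* p ℕ.* p) + ι (4 ℕ.* p) + 1ℚ    ≡⟨ cong₂ (λ x y → x + y + 1ℚ)
                                                 (trans (ι-homo-* (2 ℕ.* p) p) (cong (_* ι p) (ι-homo-* 2 p)))
                                                 (ι-homo-* 4 p) ⟩
    Q ∎
  eq′ : ι 4 * ι c + ι m ≡ Q + ι n
  eq′ = begin
    ι 4 * ι c + ι m    ≡⟨ cong (_+ ι m) (ι-homo-* 4 c) ⟨
    ι (4 ℕ.* c) + ι m  ≡⟨ ι-homo-+ (4 ℕ.* c) m ⟨
    ι (4 ℕ.* c ℕ.+ m)  ≡⟨ cong ι eq ⟩
    ι (2 ℕ.* p ℕ.* p ℕ.+ 4 ℕ.* p ℕ.+ 1 ℕ.+ n) ≡⟨ ι-homo-+ (2 ℕ.* p ℕ.* p ℕ.+ 4 ℕ.* p ℕ.+ 1) n ⟩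
    ι (2 ℕ.* p ℕ.* p ℕ.+ 4 ℕ.* p ℕ.+ 1) + ι n ≡⟨ cong (_+ ι n) ι-Q ⟩
    Q + ι n ∎

radicand-suc : ∀ p′ → radicand (suc p′) ≡ ι (1 ℕ.+ 4 ℕ.* p′)
radicand-suc p′ = begin
  ι 4 * ι (1 ℕ.+ p′) - ι 3   ≡⟨ cong (λ x → ι 4 * x - ι 3) (ι-homo-+ 1 p′) ⟩
  ι 4 * (1ℚ + ι p′) - ι 3    ≡⟨ solve 1 (λ P → con (ι 4) :* (con 1ℚ :+ P) :- con (ι 3) := con 1ℚ :+ con (ι 4) :* P) refl (ι p′) ⟩
  1ℚ + ι 4 * ι p′            ≡⟨ cong (λ x → 1ℚ + x) (ι-homo-* 4 p′) ⟨
  1ℚ + ι (4 ℕ.* p′)          ≡⟨ ι-homo-+ 1 (4 ℕ.* p′) ⟨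
  ι (1 ℕ.+ 4 ℕ.* p′)         ∎
  where
  open ≡-Reasoning
  open +-*-Solver

-- The bound and its equality case for natural `e`, `f`, `g`.

module _ (p C e f g : ℕ) where
  private
    Q = 2 ℕ.* p ℕ.* p ℕ.+ 4 ℕ.* p ℕ.+ 1

  -- The conclusion of the theorem with natural parameters left free, so that the case split can
  -- substitute `e = 2` and `g = 1`.
  Criterion : Set
  Criterion = fromℚ (ι C) ≤ᵣ bound p × ((fromℚ (ι C) ≃ᵣ bound p) ⇔ (e ≡ 2 × f ≡ 1 × g ≡ 1))

  -- Here the excess is negative, while equality with the bound would make it non-negative; both
  -- sides of the equivalence are false.
  slack-criterion : ¬ (e ≡ 2 × g ≡ 1) × 4 ℕ.* C ℕ.< Q → Criterion
  slack-criterion (not-tight , 4C<Q) =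
    excess≤√⇒≤bound p (ι C) (inj₁ (<⇒≤ w<0)) ,
    mk⇔ (λ (_ , bound≤C) → ⊥-elim (<-irrefl refl (≤-<-trans (proj₁ (bound≤⇒√≤excess p (ι C) bound≤C)) w<0)))
        (λ (e≡2 , _ , g≡1) → ⊥-elim (not-tight (e≡2 , g≡1)))
    where
    m = Q ℕ.∸ 4 ℕ.* C
    w≡ : excess p (ι C) ≡ 0ℚ - ι m
    w≡ = excess-ι p C {m} {0} (trans (ℕₚ.m+[n∸m]≡n (ℕₚ.<⇒≤ 4C<Q)) (sym (ℕₚ.+-identityʳ Q)))
    w<0 : excess p (ι C) < 0ℚ
    w<0 = subst (_< 0ℚ) (sym (trans w≡ (+-identityˡ (- ι m))))
          (neg-antimono-< (ι-pos m {{ℕ.>-nonZero (ℕₚ.m<n⇒0<n∸m 4C<Q)}}))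

-- The squared excess is `1 + 4 a A` and the radicand is `1 + 4 H A`, so everything reduces to
-- comparing `a` with `H`. The relation for `f A` says `a + f′ A = H`; hence `a ≤ H`, with equality
-- exactly when `f′ = 0`.
tight-criterion : ∀ a C H f′ → let A = suc a; p = 1 ℕ.+ H ℕ.* A in
  1 ℕ.* 2 ℕ.* C ≡ p ℕ.* (p ℕ.+ 2) ℕ.+ 1 ℕ.* A → suc f′ ℕ.* A ≡ 1 ℕ.+ H →
  Criterion p C 2 (suc f′) 1
tight-criterion a C H f′ 2C fA =
  excess≤√⇒≤bound p (ι C) (inj₂ (sq≤ a≤H)) ,
  mk⇔ (λ (_ , bound≤C) → refl , f≡1 (H≤a (proj₂ (bound≤⇒√≤excess p (ι C) bound≤C))) , refl)
      (λ (_ , f≡1 , _) →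
         excess≤√⇒≤bound p (ι C) (inj₂ (sq≤ a≤H)) ,
         √≤excess⇒bound≤ p (ι C) (subst (0ℚ ≤_) (sym w≡) (ι-nonNeg (1 ℕ.+ 2 ℕ.* a)))
           (≤sq (ℕₚ.≤-reflexive (sym (a≡H f≡1)))))
  where
  A = suc a
  f = suc f′
  p = 1 ℕ.+ H ℕ.* A
  w≡ : excess p (ι C) ≡ ι (1 ℕ.+ 2 ℕ.* a)
  w≡ = trans (excess-ι p C {0} {1 ℕ.+ 2 ℕ.* a} (tight-excess p a C 2C)) (+-identityʳ (ι (1 ℕ.+ 2 ℕ.* a)))
  w² : excess p (ι C) * excess p (ι C) ≡ ι (1 ℕ.+ 4 ℕ.* (a ℕ.* A))
  w² = trans (cong₂ _*_ w≡ w≡) (trans (sym (ι-homo-* (1 ℕ.+ 2 ℕ.* a) (1 ℕ.+ 2 ℕ.* a))) (cong ι (odd-square a)))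
  a≤H : a ℕ.≤ H
  a≤H = ℕₚ.≤-trans (ℕₚ.m≤m+n a (f′ ℕ.* A)) (ℕₚ.≤-reflexive (ℕₚ.suc-injective fA))
  a≡H : f ≡ 1 → a ≡ H
  a≡H refl = trans (sym (ℕₚ.+-identityʳ a)) (ℕₚ.suc-injective fA)
  sq≤ : a ℕ.≤ H → excess p (ι C) * excess p (ι C) ≤ radicand p
  sq≤ le = subst₂ _≤_ (sym w²) (sym (radicand-suc (H ℕ.* A)))
    (ι-mono-≤ {1 ℕ.+ 4 ℕ.* (a ℕ.* A)} {1 ℕ.+ 4 ℕ.* (H ℕ.* A)} (s≤s (ℕₚ.*-monoʳ-≤ 4 (ℕₚ.*-monoˡ-≤ A le))))
  ≤sq : H ℕ.≤ a → radicand p ≤ excess p (ι C) * excess p (ι C)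
  ≤sq le = subst₂ _≤_ (sym (radicand-suc (H ℕ.* A))) (sym w²)
    (ι-mono-≤ {1 ℕ.+ 4 ℕ.* (H ℕ.* A)} {1 ℕ.+ 4 ℕ.* (a ℕ.* A)} (s≤s (ℕₚ.*-monoʳ-≤ 4 (ℕₚ.*-monoˡ-≤ A le))))
  H≤a : radicand p ≤ excess p (ι C) * excess p (ι C) → H ℕ.≤ a
  H≤a le = ℕₚ.*-cancelʳ-≤ H a A (ℕₚ.*-cancelˡ-≤ 4 (ℕ.s≤s⁻¹
    (ι-cancel-≤ {1 ℕ.+ 4 ℕ.* (H ℕ.* A)} {1 ℕ.+ 4 ℕ.* (a ℕ.* A)} (subst₂ _≤_ (radicand-suc (H ℕ.* A)) w² le))))
  f≡1 : H ℕ.≤ a → f ≡ 1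
  f≡1 H≤a = ℕₚ.*-cancelʳ-≡ f 1 A (trans fA (cong suc (trans (ℕₚ.≤-antisym H≤a a≤H) (sym (ℕₚ.+-identityʳ a)))))

criterion : ∀ A C H e f g .{{_ : ℕ.NonZero A}} → let p = 1 ℕ.+ H ℕ.* A in
  g ℕ.* e ℕ.* C ≡ p ℕ.* (p ℕ.+ e) ℕ.+ g ℕ.* A → f ℕ.* A ≡ g ℕ.+ H →
  (e ≡ 2 × g ≡ 1) ⊎ ¬ (e ≡ 2 × g ≡ 1) × 4 ℕ.* C ℕ.< 2 ℕ.* p ℕ.* p ℕ.+ 4 ℕ.* p ℕ.+ 1 →
  Criterion p C e f g
criterion (suc a) C H .2 (suc f′) .1 geC fA (inj₁ (refl , refl)) = tight-criterion a C H f′ geC fA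
-- For `f = 0` the relation would read `0 = 1 + H`.
criterion A C H .2 zero .1 _ () (inj₁ (refl , refl))
criterion A C H e f g geC fA (inj₂ slack) = slack-criterion (1 ℕ.+ H ℕ.* A) C e f g slack

-- Clearing denominators in `F` and `G`.

-- The reciprocals are independent variables, so the first step is a polynomial identity that groups
-- each with its denominator; the hypotheses then replace each group by 1.
clear-denominators : ∀ {x y z u v w a b c} h →
  x * a ≡ 1ℚ → y * b ≡ 1ℚ → z * c ≡ 1ℚ →
  u * (a * b) ≡ 1ℚ → v * (a * c) ≡ 1ℚ → w * (b * c) ≡ 1ℚ →
  (h * (x + y + z) + (u + v + w)) * (a * b * c) ≡ h * (b * c + a * c + a * b) + (c + b + a)
clear-denominators {x} {y} {z} {u} {v} {w} {a} {b} {c} h xa yb zc uab vac wbc = trans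
  (solve 10 (λ x y z u v w a b c h →
      (h :* (x :+ y :+ z) :+ (u :+ v :+ w)) :* (a :* b :* c)
      := h :* (x :* a :* (b :* c) :+ y :* b :* (a :* c) :+ z :* c :* (a :* b))
         :+ (u :* (a :* b) :* c :+ v :* (a :* c) :* b :+ w :* (b :* c) :* a))
    refl x y z u v w a b c h)
  (cong₂ (λ s t → h * s + t)
    (cong₂ _+_ (cong₂ _+_ (unit xa) (unit yb)) (unit zc))
    (cong₂ _+_ (cong₂ _+_ (unit uab) (unit vac)) (unit wbc)))
  where
  open +-*-Solver
  unit : ∀ {s t} → s ≡ 1ℚ → s * t ≡ t
  unit {t = t} refl = *-identityˡ t

ι-pairs : ∀ a b c → ι b * ι c + ι a * ι c + ι a * ι b ≡ ι (b ℕ.* c ℕ.+ a ℕ.* c ℕ.+ a ℕ.* b)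
ι-pairs a b c = begin
  ι b * ι c + ι a * ι c + ι a * ι b
    ≡⟨ cong₂ _+_ (cong₂ _+_ (ι-homo-* b c) (ι-homo-* a c)) (ι-homo-* a b) ⟨
  ι (b ℕ.* c) + ι (a ℕ.* c) + ι (a ℕ.* b)
    ≡⟨ cong (_+ ι (a ℕ.* b)) (ι-homo-+ (b ℕ.* c) (a ℕ.* c)) ⟨
  ι (b ℕ.* c ℕ.+ a ℕ.* c) + ι (a ℕ.* b)
    ≡⟨ ι-homo-+ (b ℕ.* c ℕ.+ a ℕ.* c) (a ℕ.* b) ⟨
  ι (b ℕ.* c ℕ.+ a ℕ.* c ℕ.+ a ℕ.* b) ∎
  where open ≡-Reasoning

-- Both sides are compared after multiplication by `a b c`, which is nonzero and can be cancelled.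
F-integral : ∀ a b c h f
  .{{_ : ℕ.NonZero a}} .{{_ : ℕ.NonZero b}} .{{_ : ℕ.NonZero c}}
  .{{_ : ℕ.NonZero (a ℕ.* b)}} .{{_ : ℕ.NonZero (a ℕ.* c)}} .{{_ : ℕ.NonZero (b ℕ.* c)}} →
  f ℕ.* (a ℕ.* b ℕ.* c) ≡ h ℕ.* (b ℕ.* c ℕ.+ a ℕ.* c ℕ.+ a ℕ.* b) ℕ.+ (c ℕ.+ b ℕ.+ a) →
  ι h * (+ 1 / a + + 1 / b + + 1 / c)
    + (+ 1 / (a ℕ.* b) + + 1 / (a ℕ.* c) + + 1 / (b ℕ.* c)) ≡ ι f
F-integral a b c h f eq = ι-cancelʳ (a ℕ.* b ℕ.* c) {{ℕₚ.m*n≢0 (a ℕ.* b) c}} (begin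
  F * ι (a ℕ.* b ℕ.* c)
    ≡⟨ cong (F *_) (trans (ι-homo-* (a ℕ.* b) c) (cong (_* ι c) (ι-homo-* a b))) ⟩
  F * (ι a * ι b * ι c)
    ≡⟨ clear-denominators {+ 1 / a} {+ 1 / b} {+ 1 / c}
         {+ 1 / (a ℕ.* b)} {+ 1 / (a ℕ.* c)} {+ 1 / (b ℕ.* c)} {ι a} {ι b} {ι c} (ι h)
         (/-*-ι 1 a) (/-*-ι 1 b) (/-*-ι 1 c) (inverse a b) (inverse a c) (inverse b c) ⟩
  ι h * (ι b * ι c + ι a * ι c + ι a * ι b) + (ι c + ι b + ι a)
    ≡⟨ cong₂ (λ x y → ι h * x + y) (ι-pairs a b c)
         (trans (cong (_+ ι a) (sym (ι-homo-+ c b))) (sym (ι-homo-+ (c ℕ.+ b) a))) ⟩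
  ι h * ι pairs + ι (c ℕ.+ b ℕ.+ a)
    ≡⟨ cong (_+ ι (c ℕ.+ b ℕ.+ a)) (ι-homo-* h pairs) ⟨
  ι (h ℕ.* pairs) + ι (c ℕ.+ b ℕ.+ a)
    ≡⟨ ι-homo-+ (h ℕ.* pairs) (c ℕ.+ b ℕ.+ a) ⟨
  ι (h ℕ.* pairs ℕ.+ (c ℕ.+ b ℕ.+ a))
    ≡⟨ cong ι eq ⟨
  ι (f ℕ.* (a ℕ.* b ℕ.* c))
    ≡⟨ ι-homo-* f (a ℕ.* b ℕ.* c) ⟩
  ι f * ι (a ℕ.* b ℕ.* c) ∎)
  where
  open ≡-Reasoning
  pairs = b ℕ.* c ℕ.+ a ℕ.* c ℕ.+ a ℕ.* b
  F = ι h * (+ 1 / a + + 1 / b + + 1 / c)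
    + (+ 1 / (a ℕ.* b) + + 1 / (a ℕ.* c) + + 1 / (b ℕ.* c))
  inverse : ∀ m n .{{_ : ℕ.NonZero (m ℕ.* n)}} → + 1 / (m ℕ.* n) * (ι m * ι n) ≡ 1ℚ
  inverse m n = trans (cong (λ x → + 1 / (m ℕ.* n) * x) (sym (ι-homo-* m n))) (/-*-ι 1 (m ℕ.* n))

f*a-h≡g : ∀ a f g h {x} → f ℕ.* a ≡ g ℕ.+ h → x ≡ ι f → ι a * x - ι h ≡ ι g
f*a-h≡g a f g h fa refl = begin
  ι a * ι f - ι h        ≡⟨ cong (_- ι h) (*-comm (ι a) (ι f)) ⟩
  ι f * ι a - ι h        ≡⟨ cong (_- ι h) (ι-homo-* f a) ⟨
  ι (f ℕ.* a) - ι h      ≡⟨ cong (λ x → ι x - ι h) fa ⟩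
  ι (g ℕ.+ h) - ι h      ≡⟨ cong (_- ι h) (ι-homo-+ g h) ⟩
  ι g + ι h - ι h        ≡⟨ solve 2 (λ x y → x :+ y :- y := x) refl (ι g) (ι h) ⟩
  ι g                    ∎
  where
  open ≡-Reasoning
  open +-*-Solver

-- Application to a given Korselt number.

module _ (N : K₃N) where
  open K₃N N

  private
    A*H : A ℕ.* H ≡ p ℕ.∸ 1
    A*H = m/n*n≡m H∣p-1

    p≡ : p ≡ suc (A ℕ.* H)
    p≡ = trans (sym (ℕₚ.m+[n∸m]≡n (ℕₚ.<⇒≤ 1<p))) (cong suc (sym A*H))

    B*H : B ℕ.* H ≡ q ℕ.∸ 1
    B*H = m/n*n≡m H∣q-1

    1<q : 1 ℕ.< q
    1<q = ℕₚ.<-trans 1<p p<q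

    q≡ : q ≡ suc (B ℕ.* H)
    q≡ = trans (sym (ℕₚ.m+[n∸m]≡n (ℕₚ.<⇒≤ 1<q))) (cong suc (sym B*H))

    C*H : C ℕ.* H ≡ r ℕ.∸ 1
    C*H = m/n*n≡m H∣r-1

    r≡ : r ≡ suc (C ℕ.* H)
    r≡ = trans (sym (ℕₚ.m+[n∸m]≡n (ℕₚ.<⇒≤ (ℕₚ.<-trans 1<q q<r)))) (cong suc (sym C*H))

    p≡1+HA : p ≡ 1 ℕ.+ H ℕ.* A
    p≡1+HA = trans p≡ (cong suc (ℕₚ.*-comm A H))

    C∣ : C ∣ A ℕ.+ B ℕ.+ H ℕ.* A ℕ.* B
    C∣ = korselt-∣ A B C H p≡ q≡ r≡ (subst (λ n → r ℕ.∸ 1 ∣ n ℕ.∸ 1) factorisation r-1∣n-1)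

    B∣ : B ∣ A ℕ.+ C ℕ.+ H ℕ.* A ℕ.* C
    -- `korselt-∣` treats the last factor, so `n` is reordered to end in `q`; for `A∣` it is
    -- reordered to end in `p`.
    B∣ = korselt-∣ A C B H p≡ r≡ q≡
      (subst (λ n → q ℕ.∸ 1 ∣ n ℕ.∸ 1) (trans factorisation (swap p q r)) q-1∣n-1)
      where
      swap : ∀ p q r → p ℕ.* q ℕ.* r ≡ p ℕ.* r ℕ.* q
      swap = solve-∀

    A∣ : A ∣ B ℕ.+ C ℕ.+ H ℕ.* B ℕ.* C
    A∣ = korselt-∣ B C A H q≡ r≡ p≡
      (subst (λ n → p ℕ.∸ 1 ∣ n ℕ.∸ 1) (trans factorisation (rotate p q r)) p-1∣n-1)
      where
      rotate : ∀ p q r → p ℕ.* q ℕ.* r ≡ q ℕ.* r ℕ.* p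
      rotate = solve-∀

    -- `e` will be identified with `E`; the cofactors `k` and `l` serve to derive the two
    -- divisibilities that define `g` and `f`.
    open _∣_ C∣ renaming (quotient to e; equality to eC′)
    open _∣_ B∣ renaming (quotient to k; equality to kB′)
    open _∣_ A∣ renaming (quotient to l; equality to lA′)

    A⊥B : Coprime A B
    A⊥B = coprime-AB A B C H k
      (cong₂ gcd A*H (cong₂ gcd B*H C*H))
      (sym kB′)

    B∣p+e′ : B ∣ 1 ℕ.+ H ℕ.* A ℕ.+ e
    B∣p+e′ = B∣p+e A B C H e k A⊥B (sym eC′) (sym kB′)

    open _∣_ B∣p+e′ renaming (quotient to g; equality to gB′)

    A∣g+H′ : A ∣ g ℕ.+ H
    A∣g+H′ = A∣g+H A B C H e l g A⊥B (sym eC′) (sym lA′) (sym gB′)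

    open _∣_ A∣g+H′ renaming (quotient to f; equality to fA′)

    -- Multiplied by `r - 1 = C H`, both sides become `p q - 1 = (A + B + H A B) H = e C H`.
    E≡ : E ≡ ι e
    E≡ = ι-cancelʳ (r ℕ.∸ 1) (begin
      E * ι (r ℕ.∸ 1)        ≡⟨ /-*-ι (p ℕ.* q ℕ.∸ 1) (r ℕ.∸ 1) ⟩
      ι (p ℕ.* q ℕ.∸ 1)      ≡⟨ cong ι pq-1 ⟩
      ι (e ℕ.* (r ℕ.∸ 1))    ≡⟨ ι-homo-* e (r ℕ.∸ 1) ⟩
      ι e * ι (r ℕ.∸ 1)      ∎)
      where
      open ≡-Reasoning
      pq-1 : p ℕ.* q ℕ.∸ 1 ≡ e ℕ.* (r ℕ.∸ 1)
      pq-1 = begin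
        p ℕ.* q ℕ.∸ 1                                ≡⟨ cong₂ (λ x y → x ℕ.* y ℕ.∸ 1) p≡ q≡ ⟩
        suc (A ℕ.* H) ℕ.* suc (B ℕ.* H) ℕ.∸ 1        ≡⟨ product-1 A B H ⟩
        (A ℕ.+ B ℕ.+ H ℕ.* A ℕ.* B) ℕ.* H            ≡⟨ cong (ℕ._* H) eC′ ⟩
        e ℕ.* C ℕ.* H                                ≡⟨ ℕₚ.*-assoc e C H ⟩
        e ℕ.* (C ℕ.* H)                              ≡⟨ cong (e ℕ.*_) C*H ⟩
        e ℕ.* (r ℕ.∸ 1)                              ∎

    F≡ : F ≡ ι f
    F≡ = F-integral A B C H f (FABC-expand A B C H e g f (sym eC′) (sym gB′) (sym fA′))

    G≡ : G ≡ ι g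
    G≡ = f*a-h≡g A f g H (sym fA′) F≡

    2≤e : 2 ℕ.≤ e
    2≤e = ι-cancel-≤ {2} {e} (subst (ι 2 ≤_) E≡ 2≤E)

    -- For `g = 0` the hypothesis equates a successor with 0, so only the successor clause remains.
    1≤g : ∀ {g} → 1 ℕ.+ H ℕ.* A ℕ.+ e ≡ g ℕ.* B → 1 ℕ.≤ g
    1≤g {suc _} _ = s≤s z≤n

    A<p : A ℕ.< 1 ℕ.+ H ℕ.* A
    A<p = s≤s (ℕₚ.m≤n*m A H)

  criterion′ : Criterion p C e f g
  criterion′ = subst (λ p → Criterion p C e f g) (sym p≡1+HA)
    (criterion A C H e f g geC (sym fA′) (slack-or-tight (1 ℕ.+ H ℕ.* A) A C e g A<p 2≤e (1≤g gB′) geC))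
    where
    geC = geC-expand A B C H e g (sym eC′) (sym gB′)

  ι-⇔ : (e ≡ 2 × f ≡ 1 × g ≡ 1) ⇔ (E ≡ ι 2 × F ≡ 1ℚ × G ≡ 1ℚ)
  ι-⇔ = mk⇔
    (λ (e≡2 , f≡1 , g≡1) → trans E≡ (cong ι e≡2) , trans F≡ (cong ι f≡1) , trans G≡ (cong ι g≡1))
    (λ (E≡2 , F≡1 , G≡1) → ι-injective {e} {2} (trans (sym E≡) E≡2)
                         , ι-injective {f} {1} (trans (sym F≡) F≡1)
                         , ι-injective {g} {1} (trans (sym G≡) G≡1))

theorem4p4 : (N : K₃N) → let open K₃N N in
    (fromℚ (ι C) ≤ᵣ bound p) ×
    ((fromℚ (ι C) ≃ᵣ bound p) ⇔ (E ≡ ι 2 × F ≡ 1ℚ × G ≡ 1ℚ))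
theorem4p4 N = proj₁ (criterion′ N) , ⇔-trans (proj₂ (criterion′ N)) (ι-⇔ N)
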